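{- Let $A_n=1$ if $n=2^{k+1}-2$ for some integer $k\ge0$ and $A_n=0$ otherwise, let $D(n)=\det\left(A_{i+j}\right)_{i,j=0}^{n-1}$ for $n\ge1$, $D(0)=1$ (so $D(n)\in\{1,-1\}$), and let $T_n=D(n)D(n+2)$ for $n\ge0$. Then: (i) for every $k\ge2$ and every $n$ with $2^k\le n\le 2^{k+1}-3$, $T_n=T_{2^{k+1}-3-n}$; (ii) $T_{4n}=(-1)^n$ for all $n\ge0$; (iii) $T_{2^{k+1}n+2^k-2}=(-1)^{n+1}$ for all $n\ge0$ and all $k\ge2$.
   Context: Also $T_0=1$ and $T_1=-1$. -}

module Defs where

open import Data.Bool.Base using (if_then_else_)
open import Data.Fin.Base using (Fin; zero; toℕ; punchIn)
open import Data.Integer.Base using (ℤ; 0ℤ; 1ℤ; -1ℤ; _*_; _^_)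
import Data.Integer.Properties as ℤ
open import Data.Nat.Base as ℕ using (ℕ; suc; _∸_; _≤_; _<_; s≤s)
import Data.Nat.Properties as ℕ
open import Data.Product.Base using (∃; _×_; _,_)
open import Data.Vec.Functional using (Vector)
open import Relation.Binary.PropositionalEquality using (_≡_; refl)
open import Relation.Nullary.Decidable using (Dec; does; map′)

open import Algebra.Properties.Semiring.Sum ℤ.+-*-semiring using (sum)

Matrix : ℕ → ℕ → Set
Matrix m n = Vector (Vector ℤ n) m

minor : ∀ {m n} → Fin (suc m) → Fin (suc n) → Matrix (suc m) (suc n) → Matrix m n
minor i j M r c = M (punchIn i r) (punchIn j c)

-- Laplace expansion along the first row; the empty determinant is 1.
det : ∀ {n} → Matrix n n → ℤ
det {ℕ.zero} M = 1ℤ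
det {suc n}  M = sum λ j → -1ℤ ^ toℕ j * M zero j * det (minor zero j M)

-- Since 2 ^ suc k ≥ 2, the truncated subtraction is exact.
InSupport : ℕ → Set
InSupport n = ∃ λ k → n ≡ 2 ℕ.^ suc k ∸ 2

index≤ : ∀ k → k ≤ 2 ℕ.^ suc k ∸ 2
index≤ k = ℕ.m+n≤o⇒m≤o∸n k (ℕ.≤-trans (ℕ.≤-reflexive (ℕ.+-comm k 2)) (2+k≤2^1+k k))
  where
  2+k≤2^1+k : ∀ k → 2 ℕ.+ k ≤ 2 ℕ.^ suc k
  2+k≤2^1+k ℕ.zero  = ℕ.≤-refl
  2+k≤2^1+k (suc k) = ℕ.+-mono-≤ (ℕ.m^n>0 2 (suc k))
    (ℕ.≤-trans (2+k≤2^1+k k) (ℕ.m≤m+n _ 0))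

inSupport? : ∀ n → Dec (InSupport n)
inSupport? n = map′ from to (ℕ.anyUpTo? (λ k → n ℕ.≟ 2 ℕ.^ suc k ∸ 2) (suc n))
  where
  from : (∃ λ k → k < suc n × n ≡ 2 ℕ.^ suc k ∸ 2) → InSupport n
  from (k , _ , eq) = k , eq

  to : InSupport n → ∃ λ k → k < suc n × n ≡ 2 ℕ.^ suc k ∸ 2
  to (k , refl) = k , s≤s (index≤ k) , refl

A : ℕ → ℤ
A n = if does (inSupport? n) then 1ℤ else 0ℤ

hankel : ∀ n → Matrix n n
hankel n i j = A (toℕ i ℕ.+ toℕ j)

D : ℕ → ℤ
D n = det (hankel n)

T : ℕ → ℤ
T n = D n * D (n ℕ.+ 2)

{-# OPTIONS --safe #-}
-- With 1-based indices the (i, j) entry is 1 exactly when i + j is a power of two. If h = 2 ^ k and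
-- h ≤ n < 2h, then for h ≤ i ≤ n the only nonzero entry of row i is in column 2h − i, and
-- symmetrically for columns. Deleting these rows and columns in pairs from the outside (each pair
-- costs a sign −1) and finally the central entry (h, h) leaves the Hankel matrix of size
-- 2h − 1 − n, so D(n) = (−1)^(n − h) D(2h − 1 − n). Applied to n and n + 2 this gives the reflection
-- T(n) = T(2h − 3 − n), and (ii) and (iii) follow by strong induction.
module Submission where

open import Data.Integer.Base using (-1ℤ) renaming (_^_ to _^ℤ_)
open import Data.Nat.Base using (_+_; _*_; _∸_; _^_; _≤_)
open import Data.Product.Base using (_×_)
open import Relation.Binary.PropositionalEquality using (_≡_)
open import Defs

open import Data.Bool.Base using (if_then_else_)
open import Data.Fin.Base using (Fin; zero; suc; toℕ; punchIn; pinch; fromℕ; fromℕ<)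
open import Data.Fin.Properties using (toℕ<n; toℕ-fromℕ; toℕ-fromℕ<)
open import Data.Integer.Base using (ℤ; 0ℤ; 1ℤ) renaming (_*_ to _*ℤ_; _+_ to _+ℤ_)
import Data.Integer.Properties as ℤ
import Data.Integer.Tactic.RingSolver as ℤ-Solver
open import Data.Nat.Base using (ℕ; zero; suc; _<_; z≤n; s≤s; s≤s⁻¹)
open import Data.Nat.Induction using (<-rec)
import Data.Nat.Properties as ℕ
import Data.Nat.Tactic.RingSolver as ℕ-Solver
open import Data.Product.Base using (_,_; proj₁; proj₂; ∃-syntax)
open import Data.Sum.Base using (_⊎_; inj₁; inj₂)
open import Relation.Binary.PropositionalEquality
  using (refl; sym; trans; cong; cong₂; module ≡-Reasoning)
open import Relation.Nullary.Decidable using (dec-true; dec-false)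
open import Relation.Nullary.Negation using (¬_)

open import Algebra.Properties.Semiring.Sum ℤ.+-*-semiring
  using (sum; sum-remove; sum-cong-≗; sum-replicate-zero; *-distribˡ-sum)

-- Laplace expansion at a row or column with at most one nonzero entry.

sgn : ℕ → ℤ
sgn n = -1ℤ ^ℤ n

sgn-+ : ∀ m n → sgn (m + n) ≡ sgn m *ℤ sgn n
sgn-+ = ℤ.^-distribˡ-+-* -1ℤ

-- Once column `punchIn c j` is deleted, the old column `c` sits at position `pinch j c`. This lemma
-- and the next two interchange the order in which two columns are deleted; the swap costs a sign
-- -1.
punchIn-pinch : ∀ {n} (c : Fin (suc n)) (j : Fin n) → punchIn (punchIn c j) (pinch j c) ≡ c
punchIn-pinch zero    zero    = refl
punchIn-pinch zero    (suc j) = refl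
punchIn-pinch (suc c) zero    = refl
punchIn-pinch (suc c) (suc j) = cong suc (punchIn-pinch c j)

punchIn-punchIn : ∀ {n} (c : Fin (suc (suc n))) (j : Fin (suc n)) (k : Fin n) →
  punchIn (punchIn c j) (punchIn (pinch j c) k) ≡ punchIn c (punchIn j k)
punchIn-punchIn zero    j       k       = refl
punchIn-punchIn (suc c) zero    k       = refl
punchIn-punchIn (suc c) (suc j) zero    = refl
punchIn-punchIn (suc c) (suc j) (suc k) = cong suc (punchIn-punchIn c j k)

sgn-punchIn-pinch : ∀ {n} (c : Fin (suc n)) (j : Fin n) →
  sgn (toℕ (punchIn c j)) *ℤ sgn (toℕ (pinch j c)) ≡ -1ℤ *ℤ sgn (toℕ c) *ℤ sgn (toℕ j)
sgn-punchIn-pinch zero    zero    = refl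
sgn-punchIn-pinch zero    (suc j) = ℤ.*-identityʳ _
sgn-punchIn-pinch (suc c) zero    = lemma (sgn (toℕ c))
  where
  lemma : ∀ x → 1ℤ *ℤ x ≡ -1ℤ *ℤ (-1ℤ *ℤ x) *ℤ 1ℤ
  lemma = ℤ-Solver.solve-∀
sgn-punchIn-pinch (suc c) (suc j) = begin
  -1ℤ *ℤ p *ℤ (-1ℤ *ℤ q)                 ≡⟨ lemma p q ⟩
  p *ℤ q                                 ≡⟨ sgn-punchIn-pinch c j ⟩
  -1ℤ *ℤ x *ℤ y                          ≡⟨ lemma′ x y ⟩
  -1ℤ *ℤ (-1ℤ *ℤ x) *ℤ (-1ℤ *ℤ y)        ∎
  where
  open ≡-Reasoning
  p = sgn (toℕ (punchIn c j))
  q = sgn (toℕ (pinch j c))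
  x = sgn (toℕ c)
  y = sgn (toℕ j)
  lemma : ∀ p q → -1ℤ *ℤ p *ℤ (-1ℤ *ℤ q) ≡ p *ℤ q
  lemma = ℤ-Solver.solve-∀
  lemma′ : ∀ x y → -1ℤ *ℤ x *ℤ y ≡ -1ℤ *ℤ (-1ℤ *ℤ x) *ℤ (-1ℤ *ℤ y)
  lemma′ = ℤ-Solver.solve-∀

sum-zero : ∀ {n} (f : Fin n → ℤ) → (∀ j → f j ≡ 0ℤ) → sum f ≡ 0ℤ
sum-zero {n} f f≗0 = trans (sum-cong-≗ f≗0) (sum-replicate-zero n)

det-cong : ∀ {n} {M N : Matrix n n} → (∀ i j → M i j ≡ N i j) → det M ≡ det N
det-cong {zero}  M≗N = refl
det-cong {suc n} M≗N = sum-cong-≗ λ j →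
  cong₂ (λ x d → sgn (toℕ j) *ℤ x *ℤ d) (M≗N zero j) (det-cong λ i k → M≗N (suc i) (punchIn j k))

-- A disjunction, so that one induction covers rows and columns without passing through the
-- transpose.
Pivot : ∀ {n} → Fin (suc n) → Fin (suc n) → Matrix (suc n) (suc n) → Set
Pivot r c M = (∀ j → M r (punchIn c j) ≡ 0ℤ) ⊎ (∀ i → M (punchIn r i) c ≡ 0ℤ)

x*0*d : ∀ x d → x *ℤ 0ℤ *ℤ d ≡ 0ℤ
x*0*d = ℤ-Solver.solve-∀

-- Induction on the size, expanding along the first row. In row `zero` only the term of column `c`
-- survives. In a later row that term vanishes, every other minor inherits the pivot, and
-- interchanging the deletions gives the expansion of `minor (suc r) c M`.
det-pivot : ∀ {n} (r c : Fin (suc n)) (M : Matrix (suc n) (suc n)) → Pivot r c M →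
  det M ≡ sgn (toℕ r + toℕ c) *ℤ M r c *ℤ det (minor r c M)

-- A zero pivot makes a whole row or column vanish. In this form the induction for `det-pivot` calls
-- itself on smaller minors.
det-zero-pivot : ∀ {n} (r c : Fin (suc n)) (M : Matrix (suc n) (suc n)) → Pivot r c M →
  M r c ≡ 0ℤ → det M ≡ 0ℤ
det-zero-pivot r c M pivot Mrc≡0 = begin
  det M                              ≡⟨ det-pivot r c M pivot ⟩
  s *ℤ M r c *ℤ det (minor r c M)    ≡⟨ cong (λ x → s *ℤ x *ℤ det (minor r c M)) Mrc≡0 ⟩
  s *ℤ 0ℤ *ℤ det (minor r c M)       ≡⟨ x*0*d s _ ⟩
  0ℤ                                 ∎
  where
  open ≡-Reasoning
  s = sgn (toℕ r + toℕ c)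

det-pivot {n} zero c M pivot = begin
  det M                                      ≡⟨ sum-remove {i = c} term ⟩
  term c +ℤ sum (λ j → term (punchIn c j))   ≡⟨ cong (term c +ℤ_) (sum-zero _ (vanish M c pivot)) ⟩
  term c +ℤ 0ℤ                               ≡⟨ ℤ.+-identityʳ _ ⟩
  term c                                     ∎
  where
  open ≡-Reasoning
  term : Fin (suc n) → ℤ
  term j = sgn (toℕ j) *ℤ M zero j *ℤ det (minor zero j M)
  vanish : ∀ {n} (M : Matrix (suc n) (suc n)) c → Pivot zero c M → ∀ j →
    sgn (toℕ (punchIn c j)) *ℤ M zero (punchIn c j) *ℤ det (minor zero (punchIn c j) M) ≡ 0ℤ
  vanish {n}     M c (inj₁ row) j =
    trans (cong (λ x → sgn (toℕ (punchIn c j)) *ℤ x *ℤ det (minor zero (punchIn c j) M)) (row j))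
      (x*0*d (sgn (toℕ (punchIn c j))) _)
  vanish {suc n} M c (inj₂ col) j =
    -- Row `zero` held the only possibly nonzero entry of column `c`, so in this minor that column
    -- is entirely zero.
    trans (cong (x *ℤ_) (det-zero-pivot zero (pinch j c) (minor zero (punchIn c j) M)
        (inj₂ (λ i → column (suc i))) (column zero)))
      (ℤ.*-zeroʳ x)
    where
    x = sgn (toℕ (punchIn c j)) *ℤ M zero (punchIn c j)
    column : ∀ i → minor zero (punchIn c j) M i (pinch j c) ≡ 0ℤ
    column i = trans (cong (M (suc i)) (punchIn-pinch c j)) (col i)
det-pivot {suc n} (suc r) c M pivot = begin
  det M                                              ≡⟨ sum-remove {i = c} term ⟩
  term c +ℤ sum (λ j → term (punchIn c j))           ≡⟨ cong (_+ℤ sum (λ j → term (punchIn c j))) (vanish pivot) ⟩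
  0ℤ +ℤ sum (λ j → term (punchIn c j))               ≡⟨ ℤ.+-identityˡ _ ⟩
  sum (λ j → term (punchIn c j))                     ≡⟨ sum-cong-≗ expand ⟩
  sum (λ j → x *ℤ term′ j)                           ≡⟨ *-distribˡ-sum x term′ ⟨
  x *ℤ det (minor (suc r) c M)                       ∎
  where
  open ≡-Reasoning
  x = sgn (toℕ (suc r) + toℕ c) *ℤ M (suc r) c
  term : Fin (suc (suc n)) → ℤ
  term j = sgn (toℕ j) *ℤ M zero j *ℤ det (minor zero j M)
  term′ : Fin (suc n) → ℤ
  term′ j = sgn (toℕ j) *ℤ M zero (punchIn c j) *ℤ det (minor zero j (minor (suc r) c M))

  vanish : Pivot (suc r) c M → term c ≡ 0ℤ
  vanish (inj₁ row) = trans
    (cong (sgn (toℕ c) *ℤ M zero c *ℤ_)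
      -- With column `c` gone the pivot row is entirely zero, so any column would serve as pivot;
      -- `zero` is chosen.
      (det-zero-pivot r zero (minor zero c M) (inj₁ (λ j → row (suc j))) (row zero)))
    (ℤ.*-zeroʳ (sgn (toℕ c) *ℤ M zero c))
  vanish (inj₂ col) = trans
    (cong (λ y → sgn (toℕ c) *ℤ y *ℤ det (minor zero c M)) (col zero))
    (x*0*d (sgn (toℕ c)) _)

  pivot′ : ∀ j → Pivot (suc r) c M → Pivot r (pinch j c) (minor zero (punchIn c j) M)
  pivot′ j (inj₁ row) =
    inj₁ λ k → trans (cong (M (suc r)) (punchIn-punchIn c j k)) (row (punchIn j k))
  pivot′ j (inj₂ col) =
    inj₂ λ i → trans (cong (M (suc (punchIn r i))) (punchIn-pinch c j)) (col (suc i))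

  expand : ∀ j → term (punchIn c j) ≡ x *ℤ term′ j
  expand j = begin
    a *ℤ y *ℤ det N
      ≡⟨ cong (a *ℤ y *ℤ_) (det-pivot r (pinch j c) N (pivot′ j pivot)) ⟩
    a *ℤ y *ℤ (sgn (toℕ r + toℕ (pinch j c)) *ℤ N r (pinch j c) *ℤ det (minor r (pinch j c) N))
      ≡⟨ cong (a *ℤ y *ℤ_) (cong₂ _*ℤ_
           (cong₂ _*ℤ_ (sgn-+ (toℕ r) (toℕ (pinch j c))) (cong (M (suc r)) (punchIn-pinch c j)))
           (det-cong λ i k → cong (M (suc (punchIn r i))) (punchIn-punchIn c j k))) ⟩
    a *ℤ y *ℤ (ρ *ℤ b *ℤ z *ℤ d)
      ≡⟨ regroup a b ρ y z d ⟩
    a *ℤ b *ℤ (ρ *ℤ y *ℤ z *ℤ d)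
      -- The -1 from interchanging the columns is the one that turns the row index `r` into `suc r`.
      ≡⟨ cong (_*ℤ (ρ *ℤ y *ℤ z *ℤ d)) (sgn-punchIn-pinch c j) ⟩
    -1ℤ *ℤ γ *ℤ sgn (toℕ j) *ℤ (ρ *ℤ y *ℤ z *ℤ d)
      ≡⟨ regroup′ γ (sgn (toℕ j)) ρ y z d ⟩
    -1ℤ *ℤ (ρ *ℤ γ) *ℤ z *ℤ (sgn (toℕ j) *ℤ y *ℤ d)
      ≡⟨ cong (λ t → -1ℤ *ℤ t *ℤ z *ℤ (sgn (toℕ j) *ℤ y *ℤ d)) (sgn-+ (toℕ r) (toℕ c)) ⟨
    x *ℤ term′ j ∎
    where
    N = minor zero (punchIn c j) M
    a = sgn (toℕ (punchIn c j))
    b = sgn (toℕ (pinch j c))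
    γ = sgn (toℕ c)
    ρ = sgn (toℕ r)
    y = M zero (punchIn c j)
    z = M (suc r) c
    d = det (minor zero j (minor (suc r) c M))
    regroup : ∀ a b ρ y z d → a *ℤ y *ℤ (ρ *ℤ b *ℤ z *ℤ d) ≡ a *ℤ b *ℤ (ρ *ℤ y *ℤ z *ℤ d)
    regroup = ℤ-Solver.solve-∀
    regroup′ : ∀ γ σ ρ y z d →
      -1ℤ *ℤ γ *ℤ σ *ℤ (ρ *ℤ y *ℤ z *ℤ d) ≡ -1ℤ *ℤ (ρ *ℤ γ) *ℤ z *ℤ (σ *ℤ y *ℤ d)
    regroup′ = ℤ-Solver.solve-∀

-- The support of `A` and its gaps.

A-pow : ∀ k x → x + 2 ≡ 2 ^ suc k → A x ≡ 1ℤ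
A-pow k x x+2≡ = cong (if_then 1ℤ else 0ℤ)
  (dec-true (inSupport? x) (k , trans (sym (ℕ.m+n∸n≡m x 2)) (cong (_∸ 2) x+2≡)))

-- The hypotheses say 2 ^ k < x + 2 < 2 ^ suc k.
A-gap : ∀ k a b x → a + b + 2 ≡ 2 ^ k → x + 1 ≡ 2 ^ k + a → A x ≡ 0ℤ
A-gap k a b x ab x≡ = cong (if_then 1ℤ else 0ℤ) (dec-false (inSupport? x) not)
  where
  open ℕ.≤-Reasoning
  x+2≡ : x + 2 ≡ 2 ^ k + suc a
  x+2≡ = trans (ℕ.+-suc x 1) (trans (cong suc x≡) (sym (ℕ.+-suc (2 ^ k) a)))
  lower : 2 ^ k < x + 2
  lower = begin-strict
    2 ^ k         <⟨ ℕ.m<m+n (2 ^ k) (s≤s z≤n) ⟩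
    2 ^ k + suc a ≡⟨ x+2≡ ⟨
    x + 2         ∎
  upper : x + 2 < 2 ^ suc k
  upper = begin-strict
    x + 2               ≡⟨ x+2≡ ⟩
    2 ^ k + suc a       <⟨ ℕ.+-monoʳ-< (2 ^ k) (ℕ.m<m+n (suc a) (s≤s z≤n)) ⟩
    2 ^ k + (suc a + suc b)   ≡⟨ cong (2 ^ k +_) (lemma a b) ⟩
    2 ^ k + (a + b + 2 + 0)   ≡⟨ cong (λ h → 2 ^ k + (h + 0)) ab ⟩
    2 ^ suc k           ∎
    where
    lemma : ∀ a b → suc a + suc b ≡ a + b + 2 + 0
    lemma = ℕ-Solver.solve-∀
  not : ¬ InSupport x
  not (j , x≡2^) = compare (ℕ.≤-<-connex (suc j) k)
    where
    x+2≡2^ : x + 2 ≡ 2 ^ suc j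
    x+2≡2^ = trans (cong (_+ 2) x≡2^) (ℕ.m∸n+n≡m (ℕ.^-monoʳ-≤ 2 {1} {suc j} (s≤s z≤n)))
    compare : suc j ≤ k ⊎ k < suc j → _
    compare (inj₁ j<k) = ℕ.<⇒≱ lower (ℕ.≤-trans (ℕ.≤-reflexive x+2≡2^) (ℕ.^-monoʳ-≤ 2 j<k))
    compare (inj₂ k≤j) = ℕ.<⇒≱ upper (ℕ.≤-trans (ℕ.^-monoʳ-≤ 2 k≤j) (ℕ.≤-reflexive (sym x+2≡2^)))

-- Hankel matrices with omitted blocks.

-- The increasing enumeration of ℕ without the s numbers p, …, p + s ∸ 1.
skip : ℕ → ℕ → ℕ → ℕ
skip zero    s i       = s + i
skip (suc p) s zero    = zero
skip (suc p) s (suc i) = suc (skip p s i)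

skip-≥ : ∀ p s d → skip p s (p + d) ≡ s + (p + d)
skip-≥ zero    s d = refl
skip-≥ (suc p) s d = trans (cong suc (skip-≥ p s d)) (sym (ℕ.+-suc s (p + d)))

skip-self : ∀ p s → skip p s p ≡ p + s
skip-self zero    s = ℕ.+-identityʳ s
skip-self (suc p) s = cong suc (skip-self p s)

skip-< : ∀ p s {i} → i < p → skip p s i ≡ i
skip-< (suc p) s {zero}  _         = refl
skip-< (suc p) s {suc i} (s≤s i<p) = cong suc (skip-< p s i<p)

skip-zero : ∀ p i → skip p 0 i ≡ i
skip-zero zero    i       = refl
skip-zero (suc p) zero    = refl
skip-zero (suc p) (suc i) = cong suc (skip-zero p i)

skip-punchIn : ∀ {n p} s (c : Fin (suc n)) → toℕ c ≡ p → ∀ j →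
  skip p s (toℕ (punchIn c j)) ≡ skip p (suc s) (toℕ j)
skip-punchIn s zero    refl j       = ℕ.+-suc s (toℕ j)
skip-punchIn s (suc c) refl zero    = refl
skip-punchIn s (suc c) refl (suc j) = cong suc (skip-punchIn s c refl j)

toℕ-punchIn-fromℕ : ∀ {n} (i : Fin n) → toℕ (punchIn (fromℕ n) i) ≡ toℕ i
toℕ-punchIn-fromℕ zero    = refl
toℕ-punchIn-fromℕ (suc i) = cong suc (toℕ-punchIn-fromℕ i)

-- The Hankel matrix without the rows p, …, p + s ∸ 1 and the columns p, …, p + t ∸ 1, cut to size n.
H : ∀ n (p s t : ℕ) → Matrix n n
H n p s t i j = A (skip p s (toℕ i) + skip p t (toℕ j))

-- Position `p` is the first one behind the omitted block, so deleting column `p` lengthens the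
-- block by one, while deleting the last row merely lowers the size.
minor-H-row : ∀ {n p} s t (c : Fin (suc n)) → toℕ c ≡ p → ∀ i j →
  minor (fromℕ n) c (H (suc n) p s t) i j ≡ H n p s (suc t) i j
minor-H-row {p = p} s t c c≡p i j =
  cong₂ (λ x y → A (skip p s x + y)) (toℕ-punchIn-fromℕ i) (skip-punchIn t c c≡p j)

minor-H-column : ∀ {n p} s t (r : Fin (suc n)) → toℕ r ≡ p → ∀ i j →
  minor r (fromℕ n) (H (suc n) p s t) i j ≡ H n p (suc s) t i j
minor-H-column {p = p} s t r r≡p i j =
  cong₂ (λ x y → A (x + skip p t y)) (skip-punchIn s r r≡p i) (toℕ-punchIn-fromℕ j)

-- Removing rows and columns in pairs.

sgn-double : ∀ n → sgn (n + n) ≡ 1ℤ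
sgn-double zero    = refl
sgn-double (suc n) = begin
  -1ℤ *ℤ sgn (n + suc n)          ≡⟨ cong (λ m → -1ℤ *ℤ sgn m) (ℕ.+-suc n n) ⟩
  -1ℤ *ℤ (-1ℤ *ℤ sgn (n + n))     ≡⟨ cong (λ x → -1ℤ *ℤ (-1ℤ *ℤ x)) (sgn-double n) ⟩
  1ℤ                              ∎
  where open ≡-Reasoning

1*1*d : ∀ d → 1ℤ *ℤ 1ℤ *ℤ d ≡ d
1*1*d = ℤ-Solver.solve-∀

-- The last row and column have original index p + q = 2 ^ k - 1, the centre. The diagonal entry
-- there has index 2 ^ (k + 1) - 2, while the entries to its left have indices 2 ^ k - 1 + j with j
-- < p and fall into a gap of the support.
det-H-center : ∀ k p q → suc (p + q) ≡ 2 ^ k → det (H (suc p) p q q) ≡ D p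
det-H-center k p q h≡ = begin
  det (H (suc p) p q q)
    ≡⟨ det-pivot l l (H (suc p) p q q) (inj₁ row) ⟩
  sgn (toℕ l + toℕ l) *ℤ H (suc p) p q q l l *ℤ det (minor l l (H (suc p) p q q))
    ≡⟨ cong₂ _*ℤ_ (cong₂ _*ℤ_ (sgn-double (toℕ l)) center) (det-cong rest) ⟩
  1ℤ *ℤ 1ℤ *ℤ D p
    ≡⟨ 1*1*d (D p) ⟩
  D p ∎
  where
  open ≡-Reasoning
  l = fromℕ p
  skip-l : skip p q (toℕ l) ≡ p + q
  skip-l = trans (cong (skip p q) (toℕ-fromℕ p)) (skip-self p q)
  center : H (suc p) p q q l l ≡ 1ℤ
  center = A-pow k _ (begin
    skip p q (toℕ l) + skip p q (toℕ l) + 2   ≡⟨ cong₂ (λ x y → x + y + 2) skip-l skip-l ⟩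
    p + q + (p + q) + 2                       ≡⟨ lemma (p + q) ⟩
    2 * suc (p + q)                           ≡⟨ cong (2 *_) h≡ ⟩
    2 ^ suc k                                 ∎)
    where
    lemma : ∀ m → m + m + 2 ≡ 2 * suc m
    lemma = ℕ-Solver.solve-∀
  gap : ∀ b j → suc j + b ≡ p → A (p + q + j) ≡ 0ℤ
  gap b j refl = A-gap k j (b + q) (suc j + b + q + j) (trans (lemma j b q) h≡)
    (trans (lemma′ (p + q) j) (cong (_+ j) h≡))
    where
    lemma : ∀ j b q → j + (b + q) + 2 ≡ suc (suc j + b + q)
    lemma = ℕ-Solver.solve-∀
    lemma′ : ∀ m j → m + j + 1 ≡ suc m + j
    lemma′ = ℕ-Solver.solve-∀
  row : ∀ j → H (suc p) p q q l (punchIn l j) ≡ 0ℤ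
  row j = trans
    (cong₂ (λ x y → A (x + y)) skip-l
      (trans (cong (skip p q) (toℕ-punchIn-fromℕ j)) (skip-< p q (toℕ<n j))))
    (gap (p ∸ suc (toℕ j)) (toℕ j) (ℕ.m+[n∸m]≡n (toℕ<n j)))
  -- All remaining positions lie before `p`, so the unequal blocks `q` and `suc q` shift nothing.
  rest : ∀ i j → minor l l (H (suc p) p q q) i j ≡ hankel p i j
  rest i j = trans (minor-H-row q q l (toℕ-fromℕ p) i j)
    (cong₂ (λ x y → A (x + y)) (skip-< p q (toℕ<n i)) (skip-< p (suc q) (toℕ<n j)))

-- The outermost index `L` has partner `p + q`, since L + (p + q) + 2 = 2 ^ (k + 1). Row `L` and
-- column `p + q` are deleted first, then row `p + q` and column `L`. The positions (n + 1, p) and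
-- (p, n) have sums of opposite parity, hence the sign -1.
det-H-step : ∀ k p e q → p + e + q + 2 ≡ 2 ^ k → let n = suc (p + (e + e)) in
  det (H (suc (suc n)) p q q) ≡ -1ℤ *ℤ det (H n p (suc q) (suc q))
det-H-step k p e q h≡ = begin
  det (H (suc (suc n)) p q q)
    ≡⟨ det-pivot l c (H (suc (suc n)) p q q) (inj₁ row) ⟩
  sgn (toℕ l + toℕ c) *ℤ H (suc (suc n)) p q q l c *ℤ det (minor l c (H (suc (suc n)) p q q))
    ≡⟨ cong₂ _*ℤ_ (cong₂ (λ x y → sgn x *ℤ y) (cong₂ _+_ (toℕ-fromℕ (suc n)) c≡p) value-lc)
         (det-cong (minor-H-row q q c c≡p)) ⟩
  sgn (suc n + p) *ℤ 1ℤ *ℤ det (H (suc n) p q (suc q))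
    ≡⟨ cong (sgn (suc n + p) *ℤ 1ℤ *ℤ_) (det-pivot r l′ (H (suc n) p q (suc q)) (inj₂ column)) ⟩
  sgn (suc n + p) *ℤ 1ℤ *ℤ (sgn (toℕ r + toℕ l′) *ℤ H (suc n) p q (suc q) r l′
    *ℤ det (minor r l′ (H (suc n) p q (suc q))))
    ≡⟨ cong (sgn (suc n + p) *ℤ 1ℤ *ℤ_) (cong₂ _*ℤ_
         (cong₂ (λ x y → sgn x *ℤ y) (trans (cong₂ _+_ r≡p (toℕ-fromℕ n)) (ℕ.+-comm p n)) value-rl)
         (det-cong (minor-H-column q (suc q) r r≡p))) ⟩
  -1ℤ *ℤ σ *ℤ 1ℤ *ℤ (σ *ℤ 1ℤ *ℤ d)
    ≡⟨ regroup σ d ⟩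
  -1ℤ *ℤ (σ *ℤ σ *ℤ d)
    ≡⟨ cong (λ x → -1ℤ *ℤ (x *ℤ d)) (trans (sym (sgn-+ (n + p) (n + p))) (sgn-double (n + p))) ⟩
  -1ℤ *ℤ (1ℤ *ℤ d)
    ≡⟨ cong (-1ℤ *ℤ_) (ℤ.*-identityˡ d) ⟩
  -1ℤ *ℤ d ∎
  where
  open ≡-Reasoning
  n = suc (p + (e + e))
  L = q + suc n
  σ = sgn (n + p)
  d = det (H n p (suc q) (suc q))
  p<n : p < n
  p<n = s≤s (ℕ.m≤m+n p (e + e))
  l = fromℕ (suc n)
  l′ = fromℕ n
  c : Fin (suc (suc n))
  c = fromℕ< (ℕ.m≤n⇒m≤1+n (ℕ.m≤n⇒m≤1+n p<n))
  r : Fin (suc n)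
  r = fromℕ< (ℕ.m≤n⇒m≤1+n p<n)
  c≡p : toℕ c ≡ p
  c≡p = toℕ-fromℕ< _
  r≡p : toℕ r ≡ p
  r≡p = toℕ-fromℕ< _

  regroup : ∀ σ d → -1ℤ *ℤ σ *ℤ 1ℤ *ℤ (σ *ℤ 1ℤ *ℤ d) ≡ -1ℤ *ℤ (σ *ℤ σ *ℤ d)
  regroup = ℤ-Solver.solve-∀

  skip-p : ∀ {x} → x ≡ p → skip p q x ≡ p + q
  skip-p x≡p = trans (cong (skip p q) x≡p) (skip-self p q)
  skip-l : skip p q (toℕ l) ≡ L
  skip-l = begin
    skip p q (toℕ l)                   ≡⟨ cong (skip p q) (toℕ-fromℕ (suc n)) ⟩
    skip p q (suc n)                   ≡⟨ cong (skip p q) (lemma p e) ⟩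
    skip p q (p + suc (suc (e + e)))   ≡⟨ skip-≥ p q (suc (suc (e + e))) ⟩
    q + (p + suc (suc (e + e)))        ≡⟨ cong (q +_) (lemma p e) ⟨
    L                                  ∎
    where
    lemma : ∀ p e → suc (suc (p + (e + e))) ≡ p + suc (suc (e + e))
    lemma = ℕ-Solver.solve-∀
  skip-l′ : skip p (suc q) (toℕ l′) ≡ L
  skip-l′ = begin
    skip p (suc q) (toℕ l′)            ≡⟨ cong (skip p (suc q)) (toℕ-fromℕ n) ⟩
    skip p (suc q) n                   ≡⟨ cong (skip p (suc q)) (lemma p e) ⟩
    skip p (suc q) (p + suc (e + e))   ≡⟨ skip-≥ p (suc q) (suc (e + e)) ⟩
    suc q + (p + suc (e + e))          ≡⟨ cong (suc q +_) (lemma p e) ⟨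
    suc q + n                          ≡⟨ ℕ.+-suc q n ⟨
    L                                  ∎
    where
    lemma : ∀ p e → suc (p + (e + e)) ≡ p + suc (e + e)
    lemma = ℕ-Solver.solve-∀

  value : A (L + (p + q)) ≡ 1ℤ
  value = A-pow k _ (trans (lemma p e q) (cong (2 *_) h≡))
    where
    lemma : ∀ p e q → q + suc (suc (p + (e + e))) + (p + q) + 2 ≡ 2 * (p + e + q + 2)
    lemma = ℕ-Solver.solve-∀
  value-lc : H (suc (suc n)) p q q l c ≡ 1ℤ
  value-lc = trans (cong₂ (λ x y → A (x + y)) skip-l (skip-p c≡p)) value
  value-rl : H (suc n) p q (suc q) r l′ ≡ 1ℤ
  value-rl = trans (cong₂ (λ x y → A (x + y)) (skip-p r≡p) skip-l′)
    (trans (cong A (ℕ.+-comm (p + q) L)) value)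

  -- Before the partner: L + j + 2 lies strictly between 2 ^ k and 2 ^ (k + 1).
  gap-< : ∀ b j → suc j + b ≡ p → A (L + j) ≡ 0ℤ
  gap-< b j refl = A-gap k (e + 1 + j) (b + q) (L + j) (trans (lemma j b e q) h≡)
    (trans (lemma′ p e q j) (cong (_+ (e + 1 + j)) h≡))
    where
    lemma : ∀ j b e q → e + 1 + j + (b + q) + 2 ≡ suc j + b + e + q + 2
    lemma = ℕ-Solver.solve-∀
    lemma′ : ∀ p e q j → q + suc (suc (p + (e + e))) + j + 1 ≡ p + e + q + 2 + (e + 1 + j)
    lemma′ = ℕ-Solver.solve-∀
  -- Behind the partner: the sum plus 2 lies strictly between 2 ^ (k + 1) and 2 ^ (k + 2).
  gap-≥ : ∀ b δ → δ + b ≡ suc (e + e) → A (L + (suc q + (p + δ))) ≡ 0ℤ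
  gap-≥ b δ δ+b≡ = A-gap (suc k) δ (b + (p + p) + (q + q) + 1) _
    (begin
      δ + (b + (p + p) + (q + q) + 1) + 2     ≡⟨ lemma δ b p q ⟩
      (δ + b) + (p + p) + (q + q) + 3         ≡⟨ cong (λ m → m + (p + p) + (q + q) + 3) δ+b≡ ⟩
      suc (e + e) + (p + p) + (q + q) + 3     ≡⟨ lemma′ p e q ⟩
      2 * (p + e + q + 2)                     ≡⟨ cong (2 *_) h≡ ⟩
      2 ^ suc k                               ∎)
    (trans (lemma″ p e q δ) (cong (λ m → 2 * m + δ) h≡))
    where
    lemma : ∀ δ b p q → δ + (b + (p + p) + (q + q) + 1) + 2 ≡ (δ + b) + (p + p) + (q + q) + 3
    lemma = ℕ-Solver.solve-∀
    lemma′ : ∀ p e q → suc (e + e) + (p + p) + (q + q) + 3 ≡ 2 * (p + e + q + 2)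
    lemma′ = ℕ-Solver.solve-∀
    lemma″ : ∀ p e q δ →
      q + suc (suc (p + (e + e))) + (suc q + (p + δ)) + 1 ≡ 2 * (p + e + q + 2) + δ
    lemma″ = ℕ-Solver.solve-∀

  -- `skip p (suc q)` omits the partner too. Since the index sum is commutative, this serves both
  -- the last row and the last column.
  gap : ∀ j → j ≤ n → A (L + skip p (suc q) j) ≡ 0ℤ
  gap j j≤n = compare (ℕ.<-≤-connex j p)
    where
    compare : j < p ⊎ p ≤ j → A (L + skip p (suc q) j) ≡ 0ℤ
    compare (inj₁ j<p) = trans (cong (λ x → A (L + x)) (skip-< p (suc q) j<p))
      (gap-< (p ∸ suc j) j (ℕ.m+[n∸m]≡n j<p))
    compare (inj₂ p≤j) = trans
      (cong (λ x → A (L + x)) (trans (cong (skip p (suc q)) (sym p+δ≡j)) (skip-≥ p (suc q) δ)))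
      (gap-≥ (n ∸ j) δ (ℕ.+-cancelˡ-≡ p _ _ (begin
        p + (δ + (n ∸ j))   ≡⟨ ℕ.+-assoc p δ (n ∸ j) ⟨
        p + δ + (n ∸ j)     ≡⟨ cong (_+ (n ∸ j)) p+δ≡j ⟩
        j + (n ∸ j)         ≡⟨ ℕ.m+[n∸m]≡n j≤n ⟩
        n                   ≡⟨ ℕ.+-suc p (e + e) ⟨
        p + suc (e + e)     ∎)))
      where
      δ = j ∸ p
      p+δ≡j : p + δ ≡ j
      p+δ≡j = ℕ.m+[n∸m]≡n p≤j

  row : ∀ j → H (suc (suc n)) p q q l (punchIn c j) ≡ 0ℤ
  row j = trans (cong₂ (λ x y → A (x + y)) skip-l (skip-punchIn q c c≡p j))
    (gap (toℕ j) (s≤s⁻¹ (toℕ<n j)))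
  column : ∀ i → H (suc n) p q (suc q) (punchIn r i) l′ ≡ 0ℤ
  column i = trans (cong₂ (λ x y → A (x + y)) (skip-punchIn q r r≡p i) skip-l′)
    (trans (cong A (ℕ.+-comm (skip p (suc q) (toℕ i)) L))
      (gap (toℕ i) (ℕ.<⇒≤ (toℕ<n i))))

-- `e` counts the pairs still to be removed and `q` those already removed, so p + e + q is
-- invariant; at `e = zero` only the centre remains to be deleted.
det-H : ∀ k p e q → p + e + q + 1 ≡ 2 ^ k → det (H (suc (p + (e + e))) p q q) ≡ sgn e *ℤ D p
det-H k p zero q h≡ = begin
  det (H (suc (p + 0)) p q q)   ≡⟨ cong (λ n → det (H (suc n) p q q)) (ℕ.+-identityʳ p) ⟩
  det (H (suc p) p q q)         ≡⟨ det-H-center k p q (trans (lemma p q) h≡) ⟩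
  D p                           ≡⟨ ℤ.*-identityˡ (D p) ⟨
  1ℤ *ℤ D p                     ∎
  where
  open ≡-Reasoning
  lemma : ∀ p q → suc (p + q) ≡ p + 0 + q + 1
  lemma = ℕ-Solver.solve-∀
det-H k p (suc e) q h≡ = begin
  det (H (suc (p + (suc e + suc e))) p q q)
    ≡⟨ cong (λ n → det (H (suc n) p q q)) (lemma p e) ⟩
  det (H (suc (suc (suc (p + (e + e))))) p q q)
    ≡⟨ det-H-step k p e q (trans (lemma′ p e q) h≡) ⟩
  -1ℤ *ℤ det (H (suc (p + (e + e))) p (suc q) (suc q))
    ≡⟨ cong (-1ℤ *ℤ_) (det-H k p e (suc q) (trans (lemma″ p e q) h≡)) ⟩
  -1ℤ *ℤ (sgn e *ℤ D p)
    ≡⟨ ℤ.*-assoc -1ℤ (sgn e) (D p) ⟨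
  sgn (suc e) *ℤ D p ∎
  where
  open ≡-Reasoning
  lemma : ∀ p e → p + (suc e + suc e) ≡ 2 + (p + (e + e))
  lemma = ℕ-Solver.solve-∀
  lemma′ : ∀ p e q → p + e + q + 2 ≡ p + suc e + q + 1
  lemma′ = ℕ-Solver.solve-∀
  lemma″ : ∀ p e q → p + e + suc q + 1 ≡ p + suc e + q + 1
  lemma″ = ℕ-Solver.solve-∀

-- Reflection of `D` and `T`.

-- The full Hankel matrix is `H` with empty blocks, and its size 2 ^ k + e = p + 2e + 1 accounts for
-- p surviving rows, 2e rows removed in pairs, and the centre.
D-reflect : ∀ k p e → p + e + 1 ≡ 2 ^ k → D (2 ^ k + e) ≡ sgn e *ℤ D p
D-reflect k p e h≡ = begin
  D (2 ^ k + e)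
    ≡⟨ cong (λ h → D (h + e)) h≡ ⟨
  D (p + e + 1 + e)
    ≡⟨ cong D (lemma p e) ⟩
  D m
    ≡⟨ det-cong {M = H m p 0 0} {N = hankel m} (λ i j →
         cong₂ (λ x y → A (x + y)) (skip-zero p (toℕ i)) (skip-zero p (toℕ j))) ⟨
  det (H m p 0 0)
    ≡⟨ det-H k p e 0 (trans (lemma′ p e) h≡) ⟩
  sgn e *ℤ D p ∎
  where
  open ≡-Reasoning
  m = suc (p + (e + e))
  lemma : ∀ p e → p + e + 1 + e ≡ suc (p + (e + e))
  lemma = ℕ-Solver.solve-∀
  lemma′ : ∀ p e → p + e + 0 + 1 ≡ p + e + 1
  lemma′ = ℕ-Solver.solve-∀

-- Reflection exchanges the two factors of `T`: n = 2 ^ k + e goes to p + 2, and n + 2 goes to p.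
-- The signs cancel because e and e + 2 have the same parity.
T-reflect : ∀ k p e → p + e + 3 ≡ 2 ^ k → T (2 ^ k + e) ≡ T p
T-reflect k p e h≡ = begin
  D (2 ^ k + e) *ℤ D (2 ^ k + e + 2)
    ≡⟨ cong₂ _*ℤ_ (D-reflect k (p + 2) e (trans (lemma p e) h≡))
         (trans (cong D (ℕ.+-assoc (2 ^ k) e 2)) (D-reflect k p (e + 2) (trans (lemma′ p e) h≡))) ⟩
  sgn e *ℤ D (p + 2) *ℤ (sgn (e + 2) *ℤ D p)
    ≡⟨ regroup (sgn e) (sgn (e + 2)) (D p) (D (p + 2)) ⟩
  sgn e *ℤ sgn (e + 2) *ℤ T p
    ≡⟨ cong (_*ℤ T p) square ⟩
  1ℤ *ℤ T p
    ≡⟨ ℤ.*-identityˡ (T p) ⟩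
  T p ∎
  where
  open ≡-Reasoning
  lemma : ∀ p e → p + 2 + e + 1 ≡ p + e + 3
  lemma = ℕ-Solver.solve-∀
  lemma′ : ∀ p e → p + (e + 2) + 1 ≡ p + e + 3
  lemma′ = ℕ-Solver.solve-∀
  lemma″ : ∀ e → e + (e + 2) ≡ e + 1 + (e + 1)
  lemma″ = ℕ-Solver.solve-∀
  regroup : ∀ s t x y → s *ℤ y *ℤ (t *ℤ x) ≡ s *ℤ t *ℤ (x *ℤ y)
  regroup = ℤ-Solver.solve-∀
  square : sgn e *ℤ sgn (e + 2) ≡ 1ℤ
  square = trans (sym (sgn-+ e (e + 2))) (trans (cong sgn (lemma″ e)) (sgn-double (e + 1)))

-- `T` along arithmetic progressions.

-- Splits off the leading binary digit of `suc n`. The complement `p` encodes the bound e < 2 ^ k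
-- and is also the smaller number to which the induction below descends.
binary-split : ∀ n → ∃[ k ] ∃[ e ] ∃[ p ] suc n ≡ 2 ^ k + e × p + e + 1 ≡ 2 ^ k
binary-split zero = 0 , 0 , 0 , refl , refl
binary-split (suc n) with binary-split n
... | k , e , suc p , n≡ , h≡ =
  k , suc e , p , trans (cong suc n≡) (sym (ℕ.+-suc (2 ^ k) e)) ,
  trans (cong (_+ 1) (ℕ.+-suc p e)) h≡
-- A vanishing complement means e = 2 ^ k - 1, so the successor carries over to 2 ^ (k + 1), with
-- complement e + 2 ^ k = 2 ^ (k + 1) - 1.
... | k , e , zero  , n≡ , h≡ = suc k , 0 , e + 2 ^ k , n′≡ , h′≡
  where
  open ≡-Reasoning
  n′≡ : suc (suc n) ≡ 2 ^ suc k + 0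
  n′≡ = begin
    suc (suc n)         ≡⟨ cong suc n≡ ⟩
    suc (2 ^ k + e)     ≡⟨ lemma (2 ^ k) e ⟩
    2 ^ k + (e + 1) + 0 ≡⟨ cong (λ m → 2 ^ k + m + 0) h≡ ⟩
    2 ^ k + 2 ^ k + 0   ≡⟨ lemma′ (2 ^ k) ⟩
    2 * 2 ^ k + 0       ∎
    where
    lemma : ∀ h e → suc (h + e) ≡ h + (e + 1) + 0
    lemma = ℕ-Solver.solve-∀
    lemma′ : ∀ h → h + h + 0 ≡ 2 * h + 0
    lemma′ = ℕ-Solver.solve-∀
  h′≡ : e + 2 ^ k + 0 + 1 ≡ 2 ^ suc k
  h′≡ = begin
    e + 2 ^ k + 0 + 1   ≡⟨ lemma (2 ^ k) e ⟩
    2 ^ k + (e + 1)     ≡⟨ cong (2 ^ k +_) h≡ ⟩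
    2 ^ k + 2 ^ k       ≡⟨ lemma′ (2 ^ k) ⟩
    2 * 2 ^ k           ∎
    where
    lemma : ∀ h e → e + h + 0 + 1 ≡ h + (e + 1)
    lemma = ℕ-Solver.solve-∀
    lemma′ : ∀ h → h + h ≡ 2 * h
    lemma′ = ℕ-Solver.solve-∀

-- The number 2 ^ k + e equals p + 2e + 1.
sgn-complement : ∀ k e p → p + e + 1 ≡ 2 ^ k → sgn (2 ^ k + e) ≡ -1ℤ *ℤ sgn p
sgn-complement k e p h≡ = begin
  sgn (2 ^ k + e)                ≡⟨ cong (λ h → sgn (h + e)) h≡ ⟨
  sgn (p + e + 1 + e)            ≡⟨ cong sgn (lemma p e) ⟩
  -1ℤ *ℤ sgn (p + (e + e))       ≡⟨ cong (-1ℤ *ℤ_) (sgn-+ p (e + e)) ⟩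
  -1ℤ *ℤ (sgn p *ℤ sgn (e + e))  ≡⟨ cong (λ x → -1ℤ *ℤ (sgn p *ℤ x)) (sgn-double e) ⟩
  -1ℤ *ℤ (sgn p *ℤ 1ℤ)           ≡⟨ cong (-1ℤ *ℤ_) (ℤ.*-identityʳ (sgn p)) ⟩
  -1ℤ *ℤ sgn p                   ∎
  where
  open ≡-Reasoning
  lemma : ∀ p e → p + e + 1 + e ≡ suc (p + (e + e))
  lemma = ℕ-Solver.solve-∀

-- Reflection maps the class c mod 2 ^ l to the class d and reverses the parity of the quotient;
-- proving both classes at once lets the induction go through.
T-progression : ∀ l c d → c + d + 3 ≡ 2 ^ l → T d ≡ -1ℤ *ℤ T c → ∀ n →
  T (2 ^ l * n + c) ≡ sgn n *ℤ T c × T (2 ^ l * n + d) ≡ sgn n *ℤ T d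
T-progression l c d q≡ Td≡ = <-rec Goal go
  where
  open ≡-Reasoning
  Goal : ℕ → Set
  Goal n = T (2 ^ l * n + c) ≡ sgn n *ℤ T c × T (2 ^ l * n + d) ≡ sgn n *ℤ T d

  start : ∀ c → T (2 ^ l * 0 + c) ≡ 1ℤ *ℤ T c
  start c = trans (cong (λ m → T (m + c)) (ℕ.*-zeroʳ (2 ^ l))) (sym (ℤ.*-identityˡ (T c)))

  -- Reflection at 2 ^ (l + k): since c + d + 3 = 2 ^ l, the quotient 2 ^ k + e goes to its
  -- complement `p` and the remainder `c` to `d`.
  reflect : ∀ c d → c + d + 3 ≡ 2 ^ l → ∀ k e p → p + e + 1 ≡ 2 ^ k →
    T (2 ^ l * (2 ^ k + e) + c) ≡ T (2 ^ l * p + d)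
  reflect c d q≡ k e p h≡ = begin
    T (2 ^ l * (2 ^ k + e) + c)           ≡⟨ cong T (lemma (2 ^ l) (2 ^ k) e c) ⟩
    T (2 ^ l * 2 ^ k + (2 ^ l * e + c))   ≡⟨ cong (λ m → T (m + (2 ^ l * e + c))) (ℕ.^-distribˡ-+-* 2 l k) ⟨
    T (2 ^ (l + k) + (2 ^ l * e + c))     ≡⟨ T-reflect (l + k) (2 ^ l * p + d) (2 ^ l * e + c) sum≡ ⟩
    T (2 ^ l * p + d)                     ∎
    where
    lemma : ∀ q h e c → q * (h + e) + c ≡ q * h + (q * e + c)
    lemma = ℕ-Solver.solve-∀
    lemma′ : ∀ q p d e c → q * p + d + (q * e + c) + 3 ≡ q * (p + e) + (c + d + 3)
    lemma′ = ℕ-Solver.solve-∀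
    lemma″ : ∀ q p e → q * (p + e) + q ≡ q * (p + e + 1)
    lemma″ = ℕ-Solver.solve-∀
    sum≡ : 2 ^ l * p + d + (2 ^ l * e + c) + 3 ≡ 2 ^ (l + k)
    sum≡ = begin
      2 ^ l * p + d + (2 ^ l * e + c) + 3   ≡⟨ lemma′ (2 ^ l) p d e c ⟩
      2 ^ l * (p + e) + (c + d + 3)         ≡⟨ cong (2 ^ l * (p + e) +_) q≡ ⟩
      2 ^ l * (p + e) + 2 ^ l               ≡⟨ lemma″ (2 ^ l) p e ⟩
      2 ^ l * (p + e + 1)                   ≡⟨ cong (2 ^ l *_) h≡ ⟩
      2 ^ l * 2 ^ k                         ≡⟨ ℕ.^-distribˡ-+-* 2 l k ⟨
      2 ^ (l + k)                           ∎

  go : ∀ n → (∀ {m} → m < n → Goal m) → Goal n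
  go zero    _  = start c , start d
  go (suc n) ih with binary-split n
  ... | k , e , p , n≡ , h≡ =
    (begin
      T (2 ^ l * suc n + c)          ≡⟨ cong (λ m → T (2 ^ l * m + c)) n≡ ⟩
      T (2 ^ l * (2 ^ k + e) + c)    ≡⟨ reflect c d q≡ k e p h≡ ⟩
      T (2 ^ l * p + d)              ≡⟨ proj₂ (ih p<n) ⟩
      -- The sign -1 between the two classes is absorbed by the opposite parities of `p` and
      -- `suc n`.
      sgn p *ℤ T d                   ≡⟨ cong (sgn p *ℤ_) Td≡ ⟩
      sgn p *ℤ (-1ℤ *ℤ T c)          ≡⟨ regroup (sgn p) (T c) ⟩
      -1ℤ *ℤ sgn p *ℤ T c            ≡⟨ cong (_*ℤ T c) sgn-n ⟨
      sgn (suc n) *ℤ T c             ∎) ,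
    (begin
      T (2 ^ l * suc n + d)          ≡⟨ cong (λ m → T (2 ^ l * m + d)) n≡ ⟩
      T (2 ^ l * (2 ^ k + e) + d)    ≡⟨ reflect d c (trans (cong (_+ 3) (ℕ.+-comm d c)) q≡) k e p h≡ ⟩
      T (2 ^ l * p + c)              ≡⟨ proj₁ (ih p<n) ⟩
      sgn p *ℤ T c                   ≡⟨ regroup′ (sgn p) (T c) ⟩
      -1ℤ *ℤ sgn p *ℤ (-1ℤ *ℤ T c)   ≡⟨ cong₂ _*ℤ_ sgn-n Td≡ ⟨
      sgn (suc n) *ℤ T d             ∎)
    where
    sgn-n : sgn (suc n) ≡ -1ℤ *ℤ sgn p
    sgn-n = trans (cong sgn n≡) (sgn-complement k e p h≡)
    regroup : ∀ s t → s *ℤ (-1ℤ *ℤ t) ≡ -1ℤ *ℤ s *ℤ t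
    regroup = ℤ-Solver.solve-∀
    regroup′ : ∀ s t → s *ℤ t ≡ -1ℤ *ℤ s *ℤ (-1ℤ *ℤ t)
    regroup′ = ℤ-Solver.solve-∀
    p<n : p < suc n
    p<n = ℕ.≤-trans
      (ℕ.≤-trans (ℕ.m≤m+n (suc p) e) (ℕ.≤-reflexive (trans (ℕ.+-comm 1 (p + e)) h≡)))
      (ℕ.≤-trans (ℕ.m≤m+n (2 ^ k) e) (ℕ.≤-reflexive (sym n≡)))

-- The three statements.

-- The bounds make every truncated subtraction exact, so e = n - 2 ^ k and p = 2 ^ (k + 1) - 3 - n
-- satisfy p + e + 3 = 2 ^ k.
T-mirror : ∀ k n → 2 ^ k ≤ n → n ≤ 2 ^ (k + 1) ∸ 3 → 3 ≤ 2 ^ (k + 1) →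
  T n ≡ T (2 ^ (k + 1) ∸ 3 ∸ n)
T-mirror k n h≤n n≤ 3≤ = begin
  T n             ≡⟨ cong T (ℕ.m+[n∸m]≡n h≤n) ⟨
  T (2 ^ k + e)   ≡⟨ T-reflect k p e (ℕ.+-cancelˡ-≡ (2 ^ k) _ _ sum≡) ⟩
  T p             ∎
  where
  open ≡-Reasoning
  e = n ∸ 2 ^ k
  p = 2 ^ (k + 1) ∸ 3 ∸ n
  lemma : ∀ h p e → h + (p + e + 3) ≡ p + (h + e) + 3
  lemma = ℕ-Solver.solve-∀
  lemma′ : ∀ h → h * 2 ≡ h + h
  lemma′ = ℕ-Solver.solve-∀
  sum≡ : 2 ^ k + (p + e + 3) ≡ 2 ^ k + 2 ^ k
  sum≡ = begin
    2 ^ k + (p + e + 3)    ≡⟨ lemma (2 ^ k) p e ⟩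
    p + (2 ^ k + e) + 3    ≡⟨ cong (λ m → p + m + 3) (ℕ.m+[n∸m]≡n h≤n) ⟩
    p + n + 3              ≡⟨ cong (_+ 3) (ℕ.m∸n+n≡m n≤) ⟩
    2 ^ (k + 1) ∸ 3 + 3    ≡⟨ ℕ.m∸n+n≡m 3≤ ⟩
    2 ^ (k + 1)            ≡⟨ ℕ.^-distribˡ-+-* 2 k 1 ⟩
    2 ^ k * 2              ≡⟨ lemma′ (2 ^ k) ⟩
    2 ^ k + 2 ^ k          ∎

-- The four values of D around 2 ^ k come from reflecting at 2 ^ (k - 1) and at 2 ^ k.
module _ (j : ℕ) (c : ℕ) (c+2≡ : c + 2 ≡ 2 ^ suc (suc j)) where
  private
    k h : ℕ
    k = suc (suc j)
    h = 2 ^ suc j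
    open ≡-Reasoning

    -- Since c = h + (h - 2), reflection at `h` needs the parity of h - 2, which the form u + u
    -- displays.
    half : ∃[ u ] u + u + 2 ≡ h
    half = 2 ^ j ∸ 1 , trans (lemma (2 ^ j ∸ 1)) (cong (2 *_) (ℕ.m∸n+n≡m (ℕ.m^n>0 2 j)))
      where
      lemma : ∀ u → u + u + 2 ≡ 2 * (u + 1)
      lemma = ℕ-Solver.solve-∀
    u : ℕ
    u = proj₁ half

    c≡ : c ≡ h + (u + u)
    c≡ = ℕ.+-cancelʳ-≡ 2 c (h + (u + u)) (begin
      c + 2                ≡⟨ c+2≡ ⟩
      2 * h                ≡⟨ lemma h ⟩
      h + h                ≡⟨ cong (h +_) (proj₂ half) ⟨
      h + (u + u + 2)      ≡⟨ ℕ.+-assoc h (u + u) 2 ⟨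
      h + (u + u) + 2      ∎)
      where
      lemma : ∀ h → 2 * h ≡ h + h
      lemma = ℕ-Solver.solve-∀

    -- Reflection at `h` sends `c` to 1 and `suc c` to 0, and both `D 1` and `D 0` compute to 1.
    D-c : D c ≡ 1ℤ
    D-c = begin
      D c                    ≡⟨ cong D c≡ ⟩
      D (h + (u + u))        ≡⟨ D-reflect (suc j) 1 (u + u) (trans (lemma u) (proj₂ half)) ⟩
      sgn (u + u) *ℤ 1ℤ      ≡⟨ cong (_*ℤ 1ℤ) (sgn-double u) ⟩
      1ℤ                     ∎
      where
      lemma : ∀ u → 1 + (u + u) + 1 ≡ u + u + 2
      lemma = ℕ-Solver.solve-∀

    D-1+c : D (suc c) ≡ -1ℤ
    D-1+c = begin
      D (suc c)                ≡⟨ cong D (trans (cong suc c≡) (sym (ℕ.+-suc h (u + u)))) ⟩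
      D (h + suc (u + u))      ≡⟨ D-reflect (suc j) 0 (suc (u + u)) (trans (lemma u) (proj₂ half)) ⟩
      -1ℤ *ℤ sgn (u + u) *ℤ 1ℤ ≡⟨ cong (λ x → -1ℤ *ℤ x *ℤ 1ℤ) (sgn-double u) ⟩
      -1ℤ                      ∎
      where
      lemma : ∀ u → suc (u + u) + 1 ≡ u + u + 2
      lemma = ℕ-Solver.solve-∀

    -- Reflection at 2 ^ k sends c + 2 to c + 1, and c + 3 to c.
    D-2+c : D (c + 2) ≡ -1ℤ
    D-2+c = begin
      D (c + 2)                ≡⟨ cong D (trans c+2≡ (sym (ℕ.+-identityʳ (2 ^ k)))) ⟩
      D (2 ^ k + 0)            ≡⟨ D-reflect k (suc c) 0 (trans (lemma c) c+2≡) ⟩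
      1ℤ *ℤ D (suc c)          ≡⟨ cong (1ℤ *ℤ_) D-1+c ⟩
      -1ℤ                      ∎
      where
      lemma : ∀ c → suc c + 0 + 1 ≡ c + 2
      lemma = ℕ-Solver.solve-∀

    D-3+c : D (suc c + 2) ≡ -1ℤ
    D-3+c = begin
      D (suc c + 2)            ≡⟨ cong D (trans (cong suc c+2≡) (ℕ.+-comm 1 (2 ^ k))) ⟩
      D (2 ^ k + 1)            ≡⟨ D-reflect k c 1 (trans (ℕ.+-assoc c 1 1) c+2≡) ⟩
      -1ℤ *ℤ D c               ≡⟨ cong (-1ℤ *ℤ_) D-c ⟩
      -1ℤ                      ∎

  T-2^k∸2 : T c ≡ -1ℤ
  T-2^k∸2 = cong₂ _*ℤ_ D-c D-2+c

  T-2^k∸1 : T (suc c) ≡ 1ℤ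
  T-2^k∸1 = cong₂ _*ℤ_ D-1+c D-3+c

theorem2p7 : (∀ k n → 2 ≤ k → 2 ^ k ≤ n → n ≤ 2 ^ (k + 1) ∸ 3 → T n ≡ T (2 ^ (k + 1) ∸ 3 ∸ n))
    × (∀ n → T (4 * n) ≡ -1ℤ ^ℤ n)
    × (∀ n k → 2 ≤ k → T (2 ^ (k + 1) * n + 2 ^ k ∸ 2) ≡ -1ℤ ^ℤ (n + 1))
theorem2p7 = mirror , multiples-of-4 , two-adic
  where
  open ≡-Reasoning
  mirror : ∀ k n → 2 ≤ k → 2 ^ k ≤ n → n ≤ 2 ^ (k + 1) ∸ 3 → T n ≡ T (2 ^ (k + 1) ∸ 3 ∸ n)
  mirror k n 2≤k h≤n n≤ = T-mirror k n h≤n n≤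
    (ℕ.≤-trans (ℕ.n≤1+n 3) (ℕ.^-monoʳ-≤ 2 (ℕ.≤-trans 2≤k (ℕ.m≤m+n k 1))))

  multiples-of-4 : ∀ n → T (4 * n) ≡ sgn n
  multiples-of-4 n = begin
    T (4 * n)       ≡⟨ cong T (ℕ.+-identityʳ (4 * n)) ⟨
    -- Modulo 4 the companion of the class 0 is 1, as 0 + 1 + 3 = 4; `T 0` and `T 1` compute to 1
    -- and -1.
    T (4 * n + 0)   ≡⟨ proj₁ (T-progression 2 0 1 refl refl n) ⟩
    sgn n *ℤ 1ℤ     ≡⟨ ℤ.*-identityʳ (sgn n) ⟩
    sgn n           ∎

  two-adic : ∀ n k → 2 ≤ k → T (2 ^ (k + 1) * n + 2 ^ k ∸ 2) ≡ sgn (n + 1)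
  two-adic n k@(suc (suc j)) (s≤s (s≤s _)) = begin
    T (2 ^ (k + 1) * n + 2 ^ k ∸ 2)   ≡⟨ cong T (ℕ.+-∸-assoc (2 ^ (k + 1) * n) 2≤2^k) ⟩
    -- Modulo 2 ^ (k + 1) the companion of 2 ^ k - 2 is 2 ^ k - 1; `T` takes the values -1 and 1
    -- there.
    T (2 ^ (k + 1) * n + c)           ≡⟨ proj₁ (T-progression (k + 1) c (suc c) q≡ T-1+c≡ n) ⟩
    sgn n *ℤ T c                      ≡⟨ cong (sgn n *ℤ_) T-c ⟩
    sgn n *ℤ sgn 1                    ≡⟨ sgn-+ n 1 ⟨
    sgn (n + 1)                       ∎
    where
    c = 2 ^ k ∸ 2
    2≤2^k : 2 ≤ 2 ^ k
    2≤2^k = ℕ.^-monoʳ-≤ 2 {1} {k} (s≤s z≤n)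
    c+2≡ : c + 2 ≡ 2 ^ k
    c+2≡ = ℕ.m∸n+n≡m 2≤2^k
    T-c : T c ≡ -1ℤ
    T-c = T-2^k∸2 j c c+2≡
    T-1+c≡ : T (suc c) ≡ -1ℤ *ℤ T c
    T-1+c≡ = trans (T-2^k∸1 j c c+2≡) (cong (-1ℤ *ℤ_) (sym T-c))
    q≡ : c + suc c + 3 ≡ 2 ^ (k + 1)
    q≡ = begin
      c + suc c + 3   ≡⟨ lemma c ⟩
      (c + 2) * 2     ≡⟨ cong (_* 2) c+2≡ ⟩
      2 ^ k * 2       ≡⟨ ℕ.^-distribˡ-+-* 2 k 1 ⟨
      2 ^ (k + 1)     ∎
      where
      lemma : ∀ c → c + suc c + 3 ≡ (c + 2) * 2
      lemma = ℕ-Solver.solve-∀
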